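{- Let $M \models \mathbf{PA}^-$. The following are equivalent: 1. $M \models \bigcup_{n \in \omega} \mathbf{Coll}(\Sigma_n)$. 2. For every $N \models \mathbf{PA}^-$, if $M \prec N$, then $M \prec \sup_N(M) \prec N$. 3. For every $N \models \mathbf{PA}^-$, if $M \prec N$, then $\sup_N(M) \prec N$.
   Context: $\mathcal{L}_A=\{0,1,+,\times,<\}$ is the language of first-order arithmetic, and $\mathbf{PA}^-$ is the $\mathcal{L}_A$-theory of the non-negative parts of commutative discretely ordered rings. $\Delta_0=\Sigma_0=\Pi_0$ is the class of $\mathcal{L}_A$-formulas all of whose quantifiers are bounded; $\Sigma_{n+1}$ (resp. $\Pi_{n+1}$) formulas are those of the form $\exists \vec{y}\,\varphi$ with $\varphi\in\Pi_n$ (resp. $\forall \vec{y}\,\varphi$ with $\varphi\in\Sigma_n$), where $\vec{y}$ is a finite, possibly empty, tuple. Vector notation denotes finite (possibly empty) tuples of variables or elements; for tuples of the same length, $\vec{x}<\vec{u}$ means $x_i<u_i$ for every $i$. $M\prec N$ means $N$ is an elementary extension of $M$. For $M,N\models\mathbf{PA}^-$ with $M$ a substructure of $N$, $\sup_N(M):=\{a\in N\mid \exists b\in M\ (N\models a\leq b)\}$, regarded as a substructure of $N$ (it is again a model of $\mathbf{PA}^-$). $\mathbf{Coll}(\Gamma)$ is the scheme $\forall \vec{z}\,\forall \vec{u}\,(\forall \vec{x}<\vec{u}\,\exists \vec{y}\,\varphi(\vec{x},\vec{y},\vec{z})\to\exists \vec{v}\,\forall \vec{x}<\vec{u}\,\exists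 \vec{y}<\vec{v}\,\varphi(\vec{x},\vec{y},\vec{z}))$ for $\varphi\in\Gamma$. -}

module Defs where

open import Algebra.Bundles using (CommutativeRing)
open import Algebra.Core using (Op₂)
open import Algebra.Definitions using (Congruent₂)
import Algebra.Properties.Ring as RingProperties
open import Data.Empty.Polymorphic using (⊥)
open import Data.Fin.Base using (Fin; zero; suc)
open import Data.Nat.Base as ℕ using (ℕ; zero; suc)
open import Data.Product.Base using (_×_; _,_; proj₁; proj₂; Σ-syntax)
open import Data.Sum.Base using (_⊎_; inj₁; inj₂)
open import Data.Vec.Base using (Vec; []; _∷_; _++_; lookup; map)
open import Data.Vec.Relation.Binary.Pointwise.Inductive using (Pointwise)
open import Function.Base using (_on_)
open import Function.Bundles using (_⇔_)
open import Level using (Level) renaming (suc to lsuc)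
open import Relation.Binary.Core using (Rel)
open import Relation.Binary.Definitions using (_Respects₂_)
open import Relation.Binary.Structures using (IsEquivalence; IsStrictTotalOrder)
import Relation.Binary.Construct.On as On
import Relation.Binary.Construct.StrictToNonStrict as NonStrict
open import Relation.Nullary.Negation.Core using (¬_)

private
  variable
    ℓ : Level
    n : ℕ

------------------------------------------------------------------------
-- Syntax of the language {0, 1, +, ×, <}, with de Bruijn indices:
-- a term or formula over n has its free variables in Fin n, and a
-- quantifier binds variable zero.

infixl 7 _⊠_
infixl 6 _⊞_
infix  5 _≐_ _⋖_ _⋖̲_
infixr 4 _∧′_
infixr 3 _∨′_
infixr 2 _⇒′_

data Term (n : ℕ) : Set where
  var     : Fin n → Term n
  𝟘 𝟙     : Term n
  _⊞_ _⊠_ : Term n → Term n → Term n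

data Formula (n : ℕ) : Set where
  _≐_ _⋖_          : Term n → Term n → Formula n
  ⊥′               : Formula n
  _∧′_ _∨′_ _⇒′_   : Formula n → Formula n → Formula n
  ∀′_ ∃′_          : Formula (suc n) → Formula n

Sentence : Set
Sentence = Formula 0

_⋖̲_ : Term n → Term n → Formula n
s ⋖̲ t = s ⋖ t ∨′ s ≐ t

weaken : Term n → Term (suc n)
weaken (var i) = var (suc i)
weaken 𝟘       = 𝟘
weaken 𝟙       = 𝟙
weaken (s ⊞ t) = weaken s ⊞ weaken t
weaken (s ⊠ t) = weaken s ⊠ weaken t

-- ∀ x < t and ∃ x < t; weakening ensures that x does not occur in t.

∀<_∙_ ∃<_∙_ : Term n → Formula (suc n) → Formula n
∀< t ∙ φ = ∀′ (var zero ⋖ weaken t ⇒′ φ)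
∃< t ∙ φ = ∃′ (var zero ⋖ weaken t ∧′ φ)

∀* ∃* : ∀ m → Formula (m ℕ.+ n) → Formula n
∀* zero    φ = φ
∀* (suc m) φ = ∀* m (∀′ φ)
∃* zero    φ = φ
∃* (suc m) φ = ∃* m (∃′ φ)

data IsΔ₀ {n : ℕ} : Formula n → Set where
  eq  : ∀ s t → IsΔ₀ (s ≐ t)
  lt  : ∀ s t → IsΔ₀ (s ⋖ t)
  bot : IsΔ₀ ⊥′
  and : ∀ {φ ψ} → IsΔ₀ φ → IsΔ₀ ψ → IsΔ₀ (φ ∧′ ψ)
  or  : ∀ {φ ψ} → IsΔ₀ φ → IsΔ₀ ψ → IsΔ₀ (φ ∨′ ψ)
  imp : ∀ {φ ψ} → IsΔ₀ φ → IsΔ₀ ψ → IsΔ₀ (φ ⇒′ ψ)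
  all : ∀ t {φ : Formula (suc n)} → IsΔ₀ φ → IsΔ₀ (∀< t ∙ φ)
  ex  : ∀ t {φ : Formula (suc n)} → IsΔ₀ φ → IsΔ₀ (∃< t ∙ φ)

mutual
  data IsΣ {k : ℕ} : ℕ → Formula k → Set where
    Σ-zero : ∀ {φ} → IsΔ₀ φ → IsΣ 0 φ
    Σ-suc  : ∀ {n} m {φ : Formula (m ℕ.+ k)} → IsΠ n φ → IsΣ (suc n) (∃* m φ)

  data IsΠ {k : ℕ} : ℕ → Formula k → Set where
    Π-zero : ∀ {φ} → IsΔ₀ φ → IsΠ 0 φ
    Π-suc  : ∀ {n} m {φ : Formula (m ℕ.+ k)} → IsΣ n φ → IsΠ (suc n) (∀* m φ)

------------------------------------------------------------------------
-- Structures and satisfaction.  There are no quotient types, so equality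
-- is interpreted by a congruence _≈_; the structure meant is the quotient.

record Structure (ℓ : Level) : Set (lsuc ℓ) where
  infixl 7 _*_
  infixl 6 _+_
  infix  4 _≈_ _<_
  field
    Carrier       : Set ℓ
    _≈_           : Rel Carrier ℓ
    0# 1#         : Carrier
    _+_ _*_       : Op₂ Carrier
    _<_           : Rel Carrier ℓ
    isEquivalence : IsEquivalence _≈_
    +-cong        : Congruent₂ _≈_ _+_
    *-cong        : Congruent₂ _≈_ _*_
    <-resp-≈      : _<_ Respects₂ _≈_

  open IsEquivalence isEquivalence public
  open NonStrict _≈_ _<_ public using (_≤_)

∣_∣ : Structure ℓ → Set ℓ
∣ M ∣ = Structure.Carrier M

module _ (M : Structure ℓ) where
  open Structure M

  ⟦_⟧ : Term n → Vec ∣ M ∣ n → ∣ M ∣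
  ⟦ var i ⟧ ρ = lookup ρ i
  ⟦ 𝟘     ⟧ ρ = 0#
  ⟦ 𝟙     ⟧ ρ = 1#
  ⟦ s ⊞ t ⟧ ρ = ⟦ s ⟧ ρ + ⟦ t ⟧ ρ
  ⟦ s ⊠ t ⟧ ρ = ⟦ s ⟧ ρ * ⟦ t ⟧ ρ

  infix 1 _⊨_[_] _⊨_

  _⊨_[_] : Formula n → Vec ∣ M ∣ n → Set ℓ
  _⊨_[_] (s ≐ t)  ρ = ⟦ s ⟧ ρ ≈ ⟦ t ⟧ ρ
  _⊨_[_] (s ⋖ t)  ρ = ⟦ s ⟧ ρ < ⟦ t ⟧ ρ
  _⊨_[_] ⊥′       ρ = ⊥
  _⊨_[_] (φ ∧′ ψ) ρ = _⊨_[_] φ ρ × _⊨_[_] ψ ρ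
  _⊨_[_] (φ ∨′ ψ) ρ = _⊨_[_] φ ρ ⊎ _⊨_[_] ψ ρ
  _⊨_[_] (φ ⇒′ ψ) ρ = _⊨_[_] φ ρ → _⊨_[_] ψ ρ
  _⊨_[_] (∀′ φ)   ρ = ∀ a → _⊨_[_] φ (a ∷ ρ)
  _⊨_[_] (∃′ φ)   ρ = Σ[ a ∈ ∣ M ∣ ] _⊨_[_] φ (a ∷ ρ)

  _⊨_ : Sentence → Set ℓ
  _⊨_ σ = _⊨_[_] σ []

------------------------------------------------------------------------
-- Discretely ordered rings, their non-negative parts, and PA⁻

record DiscretelyOrderedRing (ℓ : Level) : Set (lsuc ℓ) where
  infix 4 _<_
  field
    commutativeRing    : CommutativeRing ℓ ℓ
  open CommutativeRing commutativeRing public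
  field
    _<_                : Rel Carrier ℓ
    isStrictTotalOrder : IsStrictTotalOrder _≈_ _<_
    +-monoˡ-<          : ∀ z {x y} → x < y → x + z < y + z
    *-pos              : ∀ {x y} → 0# < x → 0# < y → 0# < x * y
    0<1                : 0# < 1#
    discrete           : ∀ x → ¬ (0# < x × x < 1#)

  module Order = IsStrictTotalOrder isStrictTotalOrder
  open NonStrict _≈_ _<_ public using (_≤_)

module DORProperties (R : DiscretelyOrderedRing ℓ) where
  open DiscretelyOrderedRing R
  open RingProperties ring using ([y-z]x≈yx-zx)

  private
    <-≈ : ∀ {x y z} → x < y → y ≈ z → x < z
    <-≈ p q = proj₁ Order.<-resp-≈ q p

    ≈-< : ∀ {x y z} → x ≈ y → y < z → x < z
    ≈-< p q = proj₂ Order.<-resp-≈ (sym p) q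

    x-y+y≈x : ∀ x y → (x - y) + y ≈ x
    x-y+y≈x x y = trans (+-assoc x (- y) y) (trans (+-congˡ (-‿inverseˡ y)) (+-identityʳ x))

  ≤-trans : ∀ {x y z} → x ≤ y → y ≤ z → x ≤ z
  ≤-trans = NonStrict.trans _≈_ _<_ isEquivalence Order.<-resp-≈ Order.trans

  ≤-resp-≈ : ∀ {x x′ y y′} → x ≈ x′ → y ≈ y′ → x ≤ y → x′ ≤ y′
  ≤-resp-≈ p q (inj₁ x<y) = inj₁ (≈-< (sym p) (<-≈ x<y q))
  ≤-resp-≈ p q (inj₂ x≈y) = inj₂ (trans (sym p) (trans x≈y q))

  +-monoˡ-≤ : ∀ z {x y} → x ≤ y → x + z ≤ y + z
  +-monoˡ-≤ z (inj₁ x<y) = inj₁ (+-monoˡ-< z x<y)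
  +-monoˡ-≤ z (inj₂ x≈y) = inj₂ (+-congʳ x≈y)

  +-mono-≤ : ∀ {x y u v} → x ≤ y → u ≤ v → x + u ≤ y + v
  +-mono-≤ {x} {y} {u} {v} p q =
    ≤-trans (+-monoˡ-≤ u p) (≤-resp-≈ (+-comm u y) (+-comm v y) (+-monoˡ-≤ y q))

  *-monoˡ-≤ : ∀ {z x y} → 0# ≤ z → x ≤ y → x * z ≤ y * z
  *-monoˡ-≤ _ (inj₂ x≈y) = inj₂ (*-congʳ x≈y)
  *-monoˡ-≤ {z} {x} {y} (inj₂ 0≈z) (inj₁ _) =
    inj₂ (trans (0* x) (sym (0* y)))
    where
    0* : ∀ w → w * z ≈ 0#
    0* w = trans (*-congˡ (sym 0≈z)) (zeroʳ w)
  *-monoˡ-≤ {z} {x} {y} (inj₁ 0<z) (inj₁ x<y) =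
    inj₁ (≈-< (sym (+-identityˡ (x * z)))
      (<-≈ (+-monoˡ-< (x * z) (<-≈ (*-pos 0<y-x 0<z) ([y-z]x≈yx-zx z y x)))
           (x-y+y≈x (y * z) (x * z))))
    where
    0<y-x : 0# < y - x
    0<y-x = ≈-< (sym (-‿inverseʳ x)) (+-monoˡ-< (- x) x<y)

  *-mono-≤ : ∀ {x y u v} → 0# ≤ u → 0# ≤ y → x ≤ y → u ≤ v → x * u ≤ y * v
  *-mono-≤ {x} {y} {u} {v} 0≤u 0≤y p q =
    ≤-trans (*-monoˡ-≤ 0≤u p) (≤-resp-≈ (*-comm u y) (*-comm v y) (*-monoˡ-≤ 0≤y q))

  0≤+ : ∀ {x y} → 0# ≤ x → 0# ≤ y → 0# ≤ x + y
  0≤+ p q = ≤-resp-≈ (+-identityˡ 0#) refl (+-mono-≤ p q)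

  0≤* : ∀ {x y} → 0# ≤ x → 0# ≤ y → 0# ≤ x * y
  0≤* {x} {y} p q = ≤-resp-≈ (zeroˡ y) refl (*-monoˡ-≤ q p)

nonNegativePart : DiscretelyOrderedRing ℓ → Structure ℓ
nonNegativePart R = record
  { Carrier       = Σ[ x ∈ Carrier ] 0# ≤ x
  ; _≈_           = _≈_ on proj₁
  ; 0#            = 0# , inj₂ refl
  ; 1#            = 1# , inj₁ 0<1
  ; _+_           = λ (x , p) (y , q) → x + y , 0≤+ p q
  ; _*_           = λ (x , p) (y , q) → x * y , 0≤* p q
  ; _<_           = _<_ on proj₁
  ; isEquivalence = On.isEquivalence proj₁ isEquivalence
  ; +-cong        = +-cong
  ; *-cong        = *-cong
  ; <-resp-≈      = proj₁ Order.<-resp-≈ , proj₂ Order.<-resp-≈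
  }
  where
  open DiscretelyOrderedRing R
  open DORProperties R

-- The set of sentences true in the non-negative part of every discretely
-- ordered ring.

PA⁻ : ∀ ℓ → Sentence → Set (lsuc ℓ)
PA⁻ ℓ σ = (R : DiscretelyOrderedRing ℓ) → nonNegativePart R ⊨ σ

_⊨PA⁻ : Structure ℓ → Set (lsuc ℓ)
_⊨PA⁻ {ℓ} M = ∀ σ → PA⁻ ℓ σ → M ⊨ σ

------------------------------------------------------------------------
-- Collection

-- M satisfies the instance of the collection scheme for φ(x⃗, y⃗, z⃗),
-- with x⃗, y⃗, z⃗ of lengths p, q, r; the Tarski clauses for the
-- quantifiers over tuples are written out.

_⊨Coll : ∀ (M : Structure ℓ) p q r → Formula (p ℕ.+ (q ℕ.+ r)) → Set ℓ
_⊨Coll M p q r φ =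
  ∀ (zs : Vec ∣ M ∣ r) (us : Vec ∣ M ∣ p) →
  (∀ (xs : Vec ∣ M ∣ p) → xs <⃗ us →
     Σ[ ys ∈ Vec ∣ M ∣ q ] (M ⊨ φ [ xs ++ ys ++ zs ])) →
  Σ[ vs ∈ Vec ∣ M ∣ q ]
    (∀ (xs : Vec ∣ M ∣ p) → xs <⃗ us →
       Σ[ ys ∈ Vec ∣ M ∣ q ] (ys <⃗ vs × (M ⊨ φ [ xs ++ ys ++ zs ])))
  where
  _<⃗_ : ∀ {m} → Vec ∣ M ∣ m → Vec ∣ M ∣ m → Set _
  _<⃗_ = Pointwise (Structure._<_ M)

_⊨Coll-Σ_ : Structure ℓ → ℕ → Set ℓ
M ⊨Coll-Σ n = ∀ p q r (φ : Formula (p ℕ.+ (q ℕ.+ r))) → IsΣ n φ → (M ⊨Coll) p q r φ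

------------------------------------------------------------------------
-- Substructures, presented as embeddings, and elementarity

record _↪_ (M N : Structure ℓ) : Set ℓ where
  private
    module M = Structure M
    module N = Structure N
  field
    to        : ∣ M ∣ → ∣ N ∣
    cong      : ∀ {a b} → a M.≈ b → to a N.≈ to b
    injective : ∀ {a b} → to a N.≈ to b → a M.≈ b
    0-homo    : to M.0# N.≈ N.0#
    1-homo    : to M.1# N.≈ N.1#
    +-homo    : ∀ a b → to (a M.+ b) N.≈ to a N.+ to b
    *-homo    : ∀ a b → to (a M.* b) N.≈ to a N.* to b
    mono      : ∀ {a b} → a M.< b → to a N.< to b
    cancel    : ∀ {a b} → to a N.< to b → a M.< b

open _↪_ using (to)

-- The embedding makes its codomain an elementary extension of (the image
-- of) its domain.

IsElementary : {M N : Structure ℓ} → M ↪ N → Set ℓ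
IsElementary {M = M} {N} i =
  ∀ {n} (φ : Formula n) (ρ : Vec ∣ M ∣ n) → (M ⊨ φ [ ρ ]) ⇔ (N ⊨ φ [ map (to i) ρ ])

------------------------------------------------------------------------
-- The substructure sup_N(M), for N ⊨ PA⁻; that hypothesis gives closure
-- under + and ×.

module _ (N : Structure ℓ) (N⊨PA⁻ : N ⊨PA⁻) where
  open Structure N

  private
    x₀ x₁ x₂ x₃ : Term 4
    x₀ = var zero
    x₁ = var (suc zero)
    x₂ = var (suc (suc zero))
    x₃ = var (suc (suc (suc zero)))

  +-mono-≤ : ∀ {a b c d} → a ≤ b → c ≤ d → a + c ≤ b + d
  +-mono-≤ {a} {b} {c} {d} p q = N⊨PA⁻
    (∀′ ∀′ ∀′ ∀′ (x₃ ⋖̲ x₂ ⇒′ x₁ ⋖̲ x₀ ⇒′ x₃ ⊞ x₁ ⋖̲ x₂ ⊞ x₀))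
    (λ R _ _ _ _ → DORProperties.+-mono-≤ R)
    a b c d p q

  *-mono-≤ : ∀ {a b c d} → a ≤ b → c ≤ d → a * c ≤ b * d
  *-mono-≤ {a} {b} {c} {d} p q = N⊨PA⁻
    (∀′ ∀′ ∀′ ∀′ (x₃ ⋖̲ x₂ ⇒′ x₁ ⋖̲ x₀ ⇒′ x₃ ⊠ x₁ ⋖̲ x₂ ⊠ x₀))
    (λ R _ (_ , 0≤b) (_ , 0≤c) _ → DORProperties.*-mono-≤ R 0≤c 0≤b)
    a b c d p q

module _ {M N : Structure ℓ} (N⊨PA⁻ : N ⊨PA⁻) (i : M ↪ N) where
  open Structure N
  private
    module M = Structure M
    module i = _↪_ i

    ≤-resp : ∀ {a b c} → b ≈ c → a ≤ b → a ≤ c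
    ≤-resp b≈c (inj₁ a<b) = inj₁ (proj₁ <-resp-≈ b≈c a<b)
    ≤-resp b≈c (inj₂ a≈b) = inj₂ (trans a≈b b≈c)

  sup : Structure ℓ
  sup = record
    { Carrier       = Σ[ a ∈ ∣ N ∣ ] Σ[ b ∈ ∣ M ∣ ] a ≤ i.to b
    ; _≈_           = _≈_ on proj₁
    ; 0#            = 0# , M.0# , inj₂ (sym i.0-homo)
    ; 1#            = 1# , M.1# , inj₂ (sym i.1-homo)
    ; _+_           = λ (a , b , p) (c , d , q) →
        a + c , b M.+ d , ≤-resp (sym (i.+-homo b d)) (+-mono-≤ N N⊨PA⁻ p q)
    ; _*_           = λ (a , b , p) (c , d , q) →
        a * c , b M.* d , ≤-resp (sym (i.*-homo b d)) (*-mono-≤ N N⊨PA⁻ p q)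
    ; _<_           = _<_ on proj₁
    ; isEquivalence = On.isEquivalence proj₁ isEquivalence
    ; +-cong        = +-cong
    ; *-cong        = *-cong
    ; <-resp-≈      = proj₁ <-resp-≈ , proj₂ <-resp-≈
    }

  M↪sup : M ↪ sup
  M↪sup = record
    { to        = λ b → i.to b , b , inj₂ refl
    ; cong      = i.cong
    ; injective = i.injective
    ; 0-homo    = i.0-homo
    ; 1-homo    = i.1-homo
    ; +-homo    = i.+-homo
    ; *-homo    = i.*-homo
    ; mono      = i.mono
    ; cancel    = i.cancel
    }

  sup↪N : sup ↪ N
  sup↪N = record
    { to        = proj₁
    ; cong      = λ p → p
    ; injective = λ p → p
    ; 0-homo    = refl
    ; 1-homo    = refl
    ; +-homo    = λ _ _ → refl
    ; *-homo    = λ _ _ → refl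
    ; mono      = λ p → p
    ; cancel    = λ p → p
    }

{-# OPTIONS --safe #-}
-- (3) ⇒ (2) is immediate, since M ≺ N and sup M ≺ N give M ≺ sup M.
--
-- (1) ⇒ (3): by prenex normal forms, M satisfies collection for every
-- formula.  Given φ, apply it to (∃ y φ(x⃗, y)) ⇒ φ(x⃗, y): for x⃗ below a
-- bound from M, a witness y can be taken below a bound from M.  This passes
-- to N by elementarity, and is the Tarski–Vaught criterion for sup M ≺ N.
--
-- (3) ⇒ (1): if collection for φ fails, choose for every v ∈ M some
-- c(v) < u⃗ such that no y⃗ < v satisfies φ(c(v), y⃗).  Let N be an ultrapower
-- of M with index set M, by an ultrafilter containing every final segment
-- {v | b < v}.  The class of c in N lies in sup M and N ⊨ ∃ y⃗ φ(c, y⃗), but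
-- a witness y⃗ in sup M would be below some b ∈ M, hence below v for almost
-- all v.
module Submission where

open import Defs
open import Axiom.ExcludedMiddle using (ExcludedMiddle)
open import Axiom.Extensionality.Propositional
  using (Extensionality; lower-extensionality)
open import Data.Bool.Base using (Bool; true; false; T)
open import Data.Bool.Properties using (T?)
open import Data.Empty using (⊥; ⊥-elim)
import Data.Empty.Polymorphic as Polymorphic
open import Data.Fin.Base as Fin using (Fin; zero; suc; _↑ˡ_; _↑ʳ_; splitAt)
open import Data.List.Base as List using (List; []; _∷_)
open import Data.List.Membership.Propositional using (_∈_)
open import Data.List.Relation.Binary.Subset.Propositional using (_⊆_)
open import Data.List.Relation.Unary.All as All using (All; []; _∷_)
import Data.List.Relation.Unary.All.Properties as All
open import Data.List.Relation.Unary.Any using (here; there)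
open import Data.Nat.Base as ℕ using (ℕ; zero; suc)
open import Data.Product.Base using (_×_; _,_; proj₁; proj₂; Σ-syntax; ∃-syntax)
open import Data.Product.Function.NonDependent.Propositional using (_×-⇔_)
open import Data.Sum.Base using (_⊎_; inj₁; inj₂; [_,_]′)
open import Data.Sum.Function.Propositional using (_⊎-⇔_)
open import Data.Unit.Base using (tt)
open import Data.Vec.Base
  using (Vec; []; _∷_; _++_; lookup; map; replicate; tabulate)
open import Data.Vec.Properties
  using (lookup-++ˡ; lookup-++ʳ; lookup-map; lookup-splitAt; map-++; map-∘;
         map-id; tabulate-∘; tabulate∘lookup)
open import Data.Vec.Relation.Binary.Pointwise.Inductive as Pointwise
  using (Pointwise; []; _∷_)
open import Data.Vec.Relation.Binary.Pointwise.Extensional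
  using (extensional⇒inductive) renaming (ext to extensional)
open import Function.Base using (_∘_; id; const)
open import Function.Bundles using (_⇔_; mk⇔; module Equivalence)
open import Function.Construct.Composition using (_⇔-∘_)
open import Function.Construct.Identity using (⇔-id)
open import Function.Construct.Symmetry using (⇔-sym)
open import Function.Related.TypeIsomorphisms using (→-cong-⇔)
open import Level using (Level; lower)
open import Relation.Binary.PropositionalEquality
  using (_≡_; refl; sym; trans; cong; cong₂; subst; subst₂)
open import Relation.Nullary.Decidable
  using (Dec; yes; no; ⌊_⌋; toWitness; fromWitness; decidable-stable)
open import Relation.Nullary.Negation using (¬_; contradiction)

open Equivalence using (to; from)

private
  variable
    a b ℓ : Level
    k m n : ℕ

-- Equivalences under quantifiers, renaming of variables, and satisfaction of quantifier blocks.

∀-cong-⇔ : {A : Set a} {P Q : A → Set b} → (∀ x → P x ⇔ Q x) → (∀ x → P x) ⇔ (∀ x → Q x)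
∀-cong-⇔ e = mk⇔ (λ f x → to (e x) (f x)) (λ f x → from (e x) (f x))

∃-cong-⇔ : {A : Set a} {P Q : A → Set b} → (∀ x → P x ⇔ Q x) →
            (Σ[ x ∈ A ] P x) ⇔ (Σ[ x ∈ A ] Q x)
∃-cong-⇔ e = mk⇔ (λ (x , p) → x , to (e x) p) (λ (x , q) → x , from (e x) q)

renameᵗ : (Fin m → Fin n) → Term m → Term n
renameᵗ f (var i) = var (f i)
renameᵗ f 𝟘       = 𝟘
renameᵗ f 𝟙       = 𝟙
renameᵗ f (s ⊞ t) = renameᵗ f s ⊞ renameᵗ f t
renameᵗ f (s ⊠ t) = renameᵗ f s ⊠ renameᵗ f t

rename : (Fin m → Fin n) → Formula m → Formula n
rename f (s ≐ t)  = renameᵗ f s ≐ renameᵗ f t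
rename f (s ⋖ t)  = renameᵗ f s ⋖ renameᵗ f t
rename f ⊥′       = ⊥′
rename f (φ ∧′ ψ) = rename f φ ∧′ rename f ψ
rename f (φ ∨′ ψ) = rename f φ ∨′ rename f ψ
rename f (φ ⇒′ ψ) = rename f φ ⇒′ rename f ψ
rename f (∀′ φ)   = ∀′ rename (Fin.lift 1 f) φ
rename f (∃′ φ)   = ∃′ rename (Fin.lift 1 f) φ

-- The language has no constant for truth, so `𝟘 ≐ 𝟘` serves as the empty conjunction.
⋀ : (Fin k → Formula n) → Formula n
⋀ {k = zero}  f = 𝟘 ≐ 𝟘
⋀ {k = suc k} f = f zero ∧′ ⋀ (f ∘ suc)

module _ (M : Structure ℓ) where
  open Structure M using (_≈_; _<_)

  private
    Renames : (Fin m → Fin n) → Vec ∣ M ∣ m → Vec ∣ M ∣ n → Set ℓ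
    Renames f σ ρ = ∀ i → lookup ρ (f i) ≡ lookup σ i

    lift-renames : ∀ (f : Fin m → Fin n) {σ ρ} → Renames f σ ρ →
                   ∀ x → Renames (Fin.lift 1 f) (x ∷ σ) (x ∷ ρ)
    lift-renames f e x zero    = refl
    lift-renames f e x (suc i) = e i

  ⟦renameᵗ⟧ : ∀ (f : Fin m → Fin n) {σ ρ} → (∀ i → lookup ρ (f i) ≡ lookup σ i) →
              ∀ t → ⟦ M ⟧ (renameᵗ f t) ρ ≡ ⟦ M ⟧ t σ
  ⟦renameᵗ⟧ f e (var i) = e i
  ⟦renameᵗ⟧ f e 𝟘       = refl
  ⟦renameᵗ⟧ f e 𝟙       = refl
  ⟦renameᵗ⟧ f e (s ⊞ t) = cong₂ (Structure._+_ M) (⟦renameᵗ⟧ f e s) (⟦renameᵗ⟧ f e t)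
  ⟦renameᵗ⟧ f e (s ⊠ t) = cong₂ (Structure._*_ M) (⟦renameᵗ⟧ f e s) (⟦renameᵗ⟧ f e t)

  -- Only the values that `ρ` takes on the image of `f` matter, so `f` may permute variables or
  -- introduce dummy ones. Under a binder `Fin.lift 1 f` fixes the new variable and the hypothesis
  -- on assignments persists.
  ⊨-rename : ∀ (f : Fin m → Fin n) {σ ρ} → (∀ i → lookup ρ (f i) ≡ lookup σ i) →
             ∀ φ → (M ⊨ rename f φ [ ρ ]) ⇔ (M ⊨ φ [ σ ])
  ⊨-rename f e (s ≐ t) = mk⇔
    (subst₂ _≈_ (⟦renameᵗ⟧ f e s) (⟦renameᵗ⟧ f e t))
    (subst₂ _≈_ (sym (⟦renameᵗ⟧ f e s)) (sym (⟦renameᵗ⟧ f e t)))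
  ⊨-rename f e (s ⋖ t) = mk⇔
    (subst₂ _<_ (⟦renameᵗ⟧ f e s) (⟦renameᵗ⟧ f e t))
    (subst₂ _<_ (sym (⟦renameᵗ⟧ f e s)) (sym (⟦renameᵗ⟧ f e t)))
  ⊨-rename f e ⊥′       = ⇔-id _
  ⊨-rename f e (φ ∧′ ψ) = ⊨-rename f e φ ×-⇔ ⊨-rename f e ψ
  ⊨-rename f e (φ ∨′ ψ) = ⊨-rename f e φ ⊎-⇔ ⊨-rename f e ψ
  ⊨-rename f e (φ ⇒′ ψ) = →-cong-⇔ (⊨-rename f e φ) (⊨-rename f e ψ)
  ⊨-rename f e (∀′ φ)   =
    ∀-cong-⇔ λ x → ⊨-rename (Fin.lift 1 f) (lift-renames f e x) φ
  ⊨-rename f e (∃′ φ)   =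
    ∃-cong-⇔ λ x → ⊨-rename (Fin.lift 1 f) (lift-renames f e x) φ

  ⊨-weaken : ∀ (φ : Formula n) x ρ → (M ⊨ rename suc φ [ x ∷ ρ ]) ⇔ (M ⊨ φ [ ρ ])
  ⊨-weaken φ x ρ = ⊨-rename suc (λ _ → refl) φ

  -- The quantifier of variable zero is the innermost of the block, so the head of the vector is
  -- chosen after its tail.
  ⊨-∀* : ∀ k (φ : Formula (k ℕ.+ n)) ρ →
         (M ⊨ ∀* k φ [ ρ ]) ⇔ (∀ (xs : Vec ∣ M ∣ k) → M ⊨ φ [ xs ++ ρ ])
  ⊨-∀* zero    φ ρ = mk⇔ (λ { p [] → p }) (λ f → f [])
  ⊨-∀* (suc k) φ ρ =
    mk⇔ (λ { f (x ∷ xs) → f xs x }) (λ f xs x → f (x ∷ xs)) ⇔-∘ ⊨-∀* k (∀′ φ) ρ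

  ⊨-∃* : ∀ k (φ : Formula (k ℕ.+ n)) ρ →
         (M ⊨ ∃* k φ [ ρ ]) ⇔ (Σ[ xs ∈ Vec ∣ M ∣ k ] (M ⊨ φ [ xs ++ ρ ]))
  ⊨-∃* zero    φ ρ = mk⇔ (λ p → [] , p) (λ { ([] , p) → p })
  ⊨-∃* (suc k) φ ρ =
    mk⇔ (λ (xs , x , p) → x ∷ xs , p) (λ { (x ∷ xs , p) → xs , x , p }) ⇔-∘ ⊨-∃* k (∃′ φ) ρ

  ⊨-⋀ : ∀ (f : Fin k → Formula n) ρ → (M ⊨ ⋀ f [ ρ ]) ⇔ (∀ i → M ⊨ f i [ ρ ])
  ⊨-⋀ {k = zero}  f ρ = mk⇔ (λ _ ()) (λ _ → Structure.refl M)
  ⊨-⋀ {k = suc k} f ρ = mk⇔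
    (λ { (p , q) zero → p ; (p , q) (suc i) → to (⊨-⋀ (f ∘ suc) ρ) q i })
    (λ h → h zero , from (⊨-⋀ (f ∘ suc) ρ) (h ∘ suc))

-- Prenex normal forms

-- The matrix of a prenex formula has no bounded quantifiers either: they move into the prefix like
-- all others and need no separate treatment.
data IsQF {n : ℕ} : Formula n → Set where
  eq  : ∀ s t → IsQF (s ≐ t)
  lt  : ∀ s t → IsQF (s ⋖ t)
  bot : IsQF ⊥′
  and : ∀ {φ ψ} → IsQF φ → IsQF ψ → IsQF (φ ∧′ ψ)
  or  : ∀ {φ ψ} → IsQF φ → IsQF ψ → IsQF (φ ∨′ ψ)
  imp : ∀ {φ ψ} → IsQF φ → IsQF ψ → IsQF (φ ⇒′ ψ)

data IsPrenex {n : ℕ} : Formula n → Set where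
  qf  : ∀ {φ} → IsQF φ → IsPrenex φ
  all : ∀ {φ : Formula (suc n)} → IsPrenex φ → IsPrenex (∀′ φ)
  ex  : ∀ {φ : Formula (suc n)} → IsPrenex φ → IsPrenex (∃′ φ)

QF⇒Δ₀ : {φ : Formula n} → IsQF φ → IsΔ₀ φ
QF⇒Δ₀ (eq s t)  = eq s t
QF⇒Δ₀ (lt s t)  = lt s t
QF⇒Δ₀ bot       = bot
QF⇒Δ₀ (and p q) = and (QF⇒Δ₀ p) (QF⇒Δ₀ q)
QF⇒Δ₀ (or p q)  = or (QF⇒Δ₀ p) (QF⇒Δ₀ q)
QF⇒Δ₀ (imp p q) = imp (QF⇒Δ₀ p) (QF⇒Δ₀ q)

-- Empty blocks turn Π-formulas into Σ-formulas one level up, and conversely. With them each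
-- quantifier costs two levels, on both sides at once. This is crude, but any level will do.
prenex-level : {φ : Formula n} → IsPrenex φ → ∃[ k ] (IsΣ k φ × IsΠ k φ)
prenex-level (qf p)  = 0 , Σ-zero (QF⇒Δ₀ p) , Π-zero (QF⇒Δ₀ p)
prenex-level (all p) with k , σ , π ← prenex-level p =
  suc (suc k) , Σ-suc 0 (Π-suc 1 σ) , Π-suc 1 (Σ-suc 0 π)
prenex-level (ex p)  with k , σ , π ← prenex-level p =
  suc (suc k) , Σ-suc 1 (Π-suc 0 σ) , Π-suc 0 (Σ-suc 1 π)

rename-QF : ∀ (f : Fin m → Fin n) {φ} → IsQF φ → IsQF (rename f φ)
rename-QF f (eq s t)  = eq _ _
rename-QF f (lt s t)  = lt _ _
rename-QF f bot       = bot
rename-QF f (and p q) = and (rename-QF f p) (rename-QF f q)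
rename-QF f (or p q)  = or (rename-QF f p) (rename-QF f q)
rename-QF f (imp p q) = imp (rename-QF f p) (rename-QF f q)

rename-prenex : ∀ (f : Fin m → Fin n) {φ} → IsPrenex φ → IsPrenex (rename f φ)
rename-prenex f (qf p)  = qf (rename-QF f p)
rename-prenex f (all p) = all (rename-prenex (Fin.lift 1 f) p)
rename-prenex f (ex p)  = ex (rename-prenex (Fin.lift 1 f) p)

module PrenexForm (em : ExcludedMiddle ℓ) (M : Structure ℓ) where
  open Structure M using (0#)

  -- Equivalence is asked for in the fixed `M` only, where excluded middle decides satisfaction and
  -- `0#` inhabits the universe.
  record HasPrenexForm (φ : Formula n) : Set ℓ where
    constructor form
    field
      {ψ}        : Formula n
      isPrenex   : IsPrenex ψ
      equivalent : ∀ ρ → (M ⊨ ψ [ ρ ]) ⇔ (M ⊨ φ [ ρ ])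

  resp-⇔ : {φ ψ : Formula n} → HasPrenexForm φ →
           (∀ ρ → (M ⊨ φ [ ρ ]) ⇔ (M ⊨ ψ [ ρ ])) → HasPrenexForm ψ
  resp-⇔ (form p e) e′ = form p λ ρ → e′ ρ ⇔-∘ e ρ

  all-form : {φ : Formula (suc n)} → HasPrenexForm φ → HasPrenexForm (∀′ φ)
  all-form (form p e) = form (all p) λ ρ → ∀-cong-⇔ λ x → e (x ∷ ρ)

  ex-form : {φ : Formula (suc n)} → HasPrenexForm φ → HasPrenexForm (∃′ φ)
  ex-form (form p e) = form (ex p) λ ρ → ∃-cong-⇔ λ x → e (x ∷ ρ)

  neg : {φ : Formula n} → IsPrenex φ → HasPrenexForm (φ ⇒′ ⊥′)
  neg (qf p)  = form (qf (imp p bot)) λ ρ → ⇔-id _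
  neg (all p) = resp-⇔ (ex-form (neg p)) λ ρ → mk⇔
    (λ (x , ¬p) f → ¬p (f x))
    (λ ¬f → decidable-stable em λ h →
       lower (¬f λ x → decidable-stable em λ ¬p → h (x , ⊥-elim ∘ ¬p)))
  neg (ex p)  = resp-⇔ (all-form (neg p)) λ ρ → mk⇔
    (λ f (x , q) → f x q)
    (λ f x q → f (x , q))

  -- Prefixes are extracted in two stages, first that of the left conjunct by `conj`, then that of
  -- the right one here. Each recursion is structural in the conjunct that is not being renamed.
  conj-QF : {φ ψ : Formula n} → IsQF φ → IsPrenex ψ → HasPrenexForm (φ ∧′ ψ)
  conj-QF p (qf q) = form (qf (and p q)) λ ρ → ⇔-id _
  conj-QF {φ = φ} p (all q) =
    resp-⇔ (all-form (conj-QF (rename-QF suc p) q)) λ ρ → mk⇔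
      -- Moving a universal quantifier out of a conjunction needs a nonempty universe; `0#` is the
      -- instance used.
      (λ f → to (⊨-weaken M φ 0# ρ) (proj₁ (f 0#)) , proj₂ ∘ f)
      (λ (r , f) x → from (⊨-weaken M φ x ρ) r , f x)
  conj-QF {φ = φ} p (ex q) =
    resp-⇔ (ex-form (conj-QF (rename-QF suc p) q)) λ ρ → mk⇔
      (λ (x , r , s) → to (⊨-weaken M φ x ρ) r , x , s)
      (λ (r , x , s) → x , from (⊨-weaken M φ x ρ) r , s)

  conj : {φ ψ : Formula n} → IsPrenex φ → IsPrenex ψ → HasPrenexForm (φ ∧′ ψ)
  conj (qf p) q = conj-QF p q
  conj {ψ = ψ} (all p) q =
    resp-⇔ (all-form (conj p (rename-prenex suc q))) λ ρ → mk⇔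
      (λ f → proj₁ ∘ f , to (⊨-weaken M ψ 0# ρ) (proj₂ (f 0#)))
      (λ (f , r) x → f x , from (⊨-weaken M ψ x ρ) r)
  conj {ψ = ψ} (ex p) q =
    resp-⇔ (ex-form (conj p (rename-prenex suc q))) λ ρ → mk⇔
      (λ (x , r , s) → (x , r) , to (⊨-weaken M ψ x ρ) s)
      (λ ((x , r) , s) → x , r , from (⊨-weaken M ψ x ρ) s)

  neg-form : {φ : Formula n} → HasPrenexForm φ → HasPrenexForm (φ ⇒′ ⊥′)
  neg-form (form p e) = resp-⇔ (neg p) λ ρ → →-cong-⇔ (e ρ) (⇔-id _)

  conj-form : {φ ψ : Formula n} → HasPrenexForm φ → HasPrenexForm ψ → HasPrenexForm (φ ∧′ ψ)
  conj-form (form p e) (form q e′) = resp-⇔ (conj p q) λ ρ → e ρ ×-⇔ e′ ρ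

  -- Disjunction and implication are rewritten classically by negation and conjunction, the only
  -- connectives past which quantifiers have to be moved.
  prenexForm : (φ : Formula n) → HasPrenexForm φ
  prenexForm (s ≐ t)  = form (qf (eq s t)) λ ρ → ⇔-id _
  prenexForm (s ⋖ t)  = form (qf (lt s t)) λ ρ → ⇔-id _
  prenexForm ⊥′       = form (qf bot) λ ρ → ⇔-id _
  prenexForm (φ ∧′ ψ) = conj-form (prenexForm φ) (prenexForm ψ)
  prenexForm (φ ∨′ ψ) =
    resp-⇔ (neg-form (conj-form (neg-form (prenexForm φ)) (neg-form (prenexForm ψ)))) λ ρ → mk⇔
      (λ h → decidable-stable em λ ¬p →
         lower (h ((⊥-elim ∘ ¬p ∘ inj₁) , (⊥-elim ∘ ¬p ∘ inj₂))))
      (λ { (inj₁ p) (¬p , _) → ¬p p ; (inj₂ q) (_ , ¬q) → ¬q q })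
  prenexForm (φ ⇒′ ψ) =
    resp-⇔ (neg-form (conj-form (prenexForm φ) (neg-form (prenexForm ψ)))) λ ρ → mk⇔
      (λ h p → decidable-stable em λ ¬q → lower (h (p , ⊥-elim ∘ ¬q)))
      (λ f (p , ¬q) → ¬q (f p))
  prenexForm (∀′ φ)   = all-form (prenexForm φ)
  prenexForm (∃′ φ)   = ex-form (prenexForm φ)

  -- Collection mentions a formula only through its satisfaction in `M`, so it passes from a prenex
  -- form, which lies in some Σ-class, to the formula itself.
  coll-prenex : (∀ n → M ⊨Coll-Σ n) → ∀ p q r φ → (M ⊨Coll) p q r φ
  coll-prenex coll p q r φ zs us h
    with form {ψ} isPrenex e ← prenexForm φ
    with n , isΣ , _ ← prenex-level isPrenex
    with vs , g ← coll n p q r ψ isΣ zs us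
                    (λ xs xs<us → let ys , s = h xs xs<us in ys , from (e _) s)
    = vs , λ xs xs<us → let ys , ys<vs , s = g xs xs<us in ys , ys<vs , to (e _) s

-- Elementary embeddings

module _ {M N : Structure ℓ} (i : M ↪ N) where
  private
    module M = Structure M
    module N = Structure N
    module i = _↪_ i

  ⟦⟧-homo : ∀ (t : Term n) ρ → i.to (⟦ M ⟧ t ρ) N.≈ ⟦ N ⟧ t (map i.to ρ)
  ⟦⟧-homo (var j) ρ = N.reflexive (sym (lookup-map j i.to ρ))
  ⟦⟧-homo 𝟘       ρ = i.0-homo
  ⟦⟧-homo 𝟙       ρ = i.1-homo
  ⟦⟧-homo (s ⊞ t) ρ = N.trans (i.+-homo _ _) (N.+-cong (⟦⟧-homo s ρ) (⟦⟧-homo t ρ))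
  ⟦⟧-homo (s ⊠ t) ρ = N.trans (i.*-homo _ _) (N.*-cong (⟦⟧-homo s ρ) (⟦⟧-homo t ρ))

  -- By induction on formulas; the criterion is used at quantifiers, to replace elements of `N` by
  -- elements of `M`.
  tarski-vaught :
    ExcludedMiddle ℓ →
    (∀ {n} (φ : Formula (suc n)) ρ → (N ⊨ ∃′ φ [ map i.to ρ ]) →
       Σ[ x ∈ ∣ M ∣ ] (N ⊨ φ [ i.to x ∷ map i.to ρ ])) →
    IsElementary i
  tarski-vaught em witness = elementary
    where
    elementary : IsElementary i
    elementary (s ≐ t) ρ = mk⇔
      (λ p → N.trans (N.sym (⟦⟧-homo s ρ)) (N.trans (i.cong p) (⟦⟧-homo t ρ)))
      (λ p → i.injective (N.trans (⟦⟧-homo s ρ) (N.trans p (N.sym (⟦⟧-homo t ρ)))))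
    elementary (s ⋖ t) ρ = mk⇔
      (λ p → proj₁ N.<-resp-≈ (⟦⟧-homo t ρ) (proj₂ N.<-resp-≈ (⟦⟧-homo s ρ) (i.mono p)))
      (λ p → i.cancel (proj₁ N.<-resp-≈ (N.sym (⟦⟧-homo t ρ))
                        (proj₂ N.<-resp-≈ (N.sym (⟦⟧-homo s ρ)) p)))
    elementary ⊥′       ρ = mk⇔ (λ { (Level.lift ()) }) (λ { (Level.lift ()) })
    elementary (φ ∧′ ψ) ρ = elementary φ ρ ×-⇔ elementary ψ ρ
    elementary (φ ∨′ ψ) ρ = elementary φ ρ ⊎-⇔ elementary ψ ρ
    elementary (φ ⇒′ ψ) ρ = →-cong-⇔ (elementary φ ρ) (elementary ψ ρ)
    elementary (∀′ φ)   ρ = mk⇔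
      (λ f b → decidable-stable em λ ¬p →
         -- A counterexample in `N` witnesses the negation, so the criterion provides a
         -- counterexample from `M`.
         let x , ¬q = witness (φ ⇒′ ⊥′) ρ (b , ⊥-elim ∘ ¬p)
         in lower (¬q (to (elementary φ (x ∷ ρ)) (f x))))
      (λ f x → from (elementary φ (x ∷ ρ)) (f (i.to x)))
    elementary (∃′ φ)   ρ = mk⇔
      (λ (x , p) → i.to x , to (elementary φ (x ∷ ρ)) p)
      (λ p → let x , q = witness φ ρ p in x , from (elementary φ (x ∷ ρ)) q)

-- Satisfaction in `M` and in the supremum are both compared with satisfaction in `N`, the composite
-- of the two embeddings being `i`.
sup↪N-elementary⇒M↪sup-elementary :
  {M N : Structure ℓ} (N⊨PA⁻ : N ⊨PA⁻) (i : M ↪ N) → IsElementary i →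
  IsElementary (sup↪N N⊨PA⁻ i) → IsElementary (M↪sup N⊨PA⁻ i)
sup↪N-elementary⇒M↪sup-elementary {N = N} N⊨PA⁻ i M≺N sup≺N φ ρ =
  ⇔-sym (sup≺N φ _) ⇔-∘
  subst (λ σ → _ ⇔ (N ⊨ φ [ σ ])) (map-∘ proj₁ (_↪_.to (M↪sup N⊨PA⁻ i)) ρ) (M≺N φ ρ)

-- Order in models of PA⁻

module _ (R : DiscretelyOrderedRing ℓ) where
  open DiscretelyOrderedRing R hiding (refl)
  open DORProperties R
  private
    module R = DiscretelyOrderedRing R

  ring-≤-<-trans : ∀ {x y z} → x ≤ y → y < z → x < z
  ring-≤-<-trans (inj₁ x<y) y<z = Order.trans x<y y<z
  ring-≤-<-trans (inj₂ x≈y) y<z = proj₂ Order.<-resp-≈ (R.sym x≈y) y<z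

  ring-x<x+1 : ∀ x → x < x + 1#
  ring-x<x+1 x = proj₁ Order.<-resp-≈ (+-comm 1# x)
    (proj₂ Order.<-resp-≈ (+-identityˡ x) (+-monoˡ-< x 0<1))

  ring-x≤x+y : ∀ {x y} → 0# ≤ y → x ≤ x + y
  ring-x≤x+y {x} 0≤y =
    ≤-resp-≈ (+-identityʳ x) R.refl (DORProperties.+-mono-≤ R (inj₂ R.refl) 0≤y)

  ring-y≤x+y : ∀ {x y} → 0# ≤ x → y ≤ x + y
  ring-y≤x+y {y = y} 0≤x =
    ≤-resp-≈ (+-identityˡ y) R.refl (DORProperties.+-mono-≤ R 0≤x (inj₂ R.refl))

module _ {M : Structure ℓ} (M⊨PA⁻ : M ⊨PA⁻) where
  open Structure M using (_≤_; _<_; _+_; 1#)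

  private
    v₀ : Term (suc n)
    v₀ = var zero
    v₁ : Term (suc (suc n))
    v₁ = var (suc zero)
    v₂ : Term (suc (suc (suc n)))
    v₂ = var (suc (suc zero))

  -- The hypothesis on `M` speaks of sentences only, so each law of order is stated as a sentence
  -- and verified in the non-negative part of every ring.
  ≤-<-trans : ∀ {x y z} → x ≤ y → y < z → x < z
  ≤-<-trans {x} {y} {z} = M⊨PA⁻
    (∀′ ∀′ ∀′ (v₂ ⋖̲ v₁ ⇒′ v₁ ⋖ v₀ ⇒′ v₂ ⋖ v₀))
    (λ R _ _ _ → ring-≤-<-trans R)
    x y z

  x<x+1 : ∀ x → x < x + 1#
  x<x+1 = M⊨PA⁻ (∀′ (v₀ ⋖ v₀ ⊞ 𝟙)) λ R (x , _) → ring-x<x+1 R x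

  x≤x+y : ∀ x y → x ≤ x + y
  x≤x+y = M⊨PA⁻ (∀′ ∀′ (v₁ ⋖̲ v₁ ⊞ v₀)) λ R _ (_ , 0≤y) → ring-x≤x+y R 0≤y

  y≤x+y : ∀ x y → y ≤ x + y
  y≤x+y = M⊨PA⁻ (∀′ ∀′ (v₀ ⋖̲ v₁ ⊞ v₀)) λ R (_ , 0≤x) _ → ring-y≤x+y R 0≤x

-- Ultrafilters

T-extensional : ∀ {x y : Bool} → (T x → T y) → (T y → T x) → x ≡ y
T-extensional {false} {false} f g = refl
T-extensional {false} {true}  f g = ⊥-elim (g tt)
T-extensional {true}  {false} f g = ⊥-elim (f tt)
T-extensional {true}  {true}  f g = refl

-- Subsets are Bool-valued, to keep sets of subsets in the universe of
-- excluded middle.  Starting from the union of the empty set, subsets are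
-- enlarged one element at a time, with unions at limits; the subsets so
-- obtained form a chain, and the largest one cannot be enlarged.
module TeichmüllerTukey
  (em : ExcludedMiddle ℓ) (ext : Extensionality ℓ ℓ)
  {A : Set ℓ} (Con : List A → Set ℓ)
  (Con-anti : ∀ {K L} → K ⊆ L → Con L → Con K) (Con-[] : Con [])
  where

  Subset : Set ℓ
  Subset = A → Bool

  Consistent : Subset → Set ℓ
  Consistent F = ∀ L → All (T ∘ F) L → Con L

  private
    infix 4 _≼_
    _≼_ : Subset → Subset → Set ℓ
    F ≼ G = ∀ x → T (F x) → T (G x)

    ≼-antisym : ∀ {F G} → F ≼ G → G ≼ F → F ≡ G
    ≼-antisym f g = lower-extensionality ℓ ℓ ext λ x → T-extensional (f x) (g x)

    ⋃ : (Subset → Bool) → Subset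
    ⋃ S x = ⌊ em {Σ[ F ∈ Subset ] (T (S F) × T (F x))} ⌋

    Extends : Subset → A → Set ℓ
    Extends F x = ¬ T (F x) × (∀ L → All (T ∘ F) L → Con (x ∷ L))

    extend : ∀ F → Dec (Σ[ x ∈ A ] Extends F x) → Subset
    extend F (yes (x , _)) y = ⌊ em {T (F y) ⊎ y ≡ x} ⌋
    extend F (no _)          = F

    next : Subset → Subset
    next F = extend F em

    extend-≼ : ∀ F d → F ≼ extend F d
    extend-≼ F (yes _) y = fromWitness ∘ inj₁
    extend-≼ F (no _)  y = id

    extend-consistent : ∀ F d → Consistent F → Consistent (extend F d)
    extend-consistent F (no _)                c   = c
    extend-consistent F (yes e@(x , _ , con)) c L L∈ =
      let K , K∈ , L⊆ = split L L∈ in Con-anti L⊆ (con K K∈)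
      where
      split : ∀ L → All (T ∘ extend F (yes e)) L →
              Σ[ K ∈ List A ] (All (T ∘ F) K × L ⊆ x ∷ K)
      split []      []       = [] , [] , λ ()
      split (y ∷ L) (p ∷ ps) with K , K∈ , L⊆ ← split L ps | toWitness p
      ... | inj₁ y∈F  = y ∷ K , y∈F ∷ K∈ ,
        λ { (here refl) → there (here refl)
          ; (there z∈) → [ here , there ∘ there ]′ (uncons (L⊆ z∈)) }
        where
        uncons : ∀ {z} → z ∈ x ∷ K → z ≡ x ⊎ z ∈ K
        uncons (here e)  = inj₁ e
        uncons (there q) = inj₂ q
      ... | inj₂ refl = K , K∈ , λ { (here refl) → here refl ; (there z∈) → L⊆ z∈ }

    extend-maximal : ∀ F d → extend F d ≼ F → ∀ x → ¬ Extends F x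
    extend-maximal F (yes (y , y∉F , _)) h x _ = y∉F (h y (fromWitness (inj₂ refl)))
    extend-maximal F (no none)           h x e = none (x , e)

    -- The least family closed under `next` and unions, in place of a transfinite recursion. `lim`
    -- admits arbitrary subfamilies; that the family is a chain is proved afterwards.
    data Tower : Subset → Set ℓ where
      step : ∀ {F} → Tower F → Tower (next F)
      lim  : ∀ S → (∀ F → T (S F) → Tower F) → Tower (⋃ S)

    ⋃-upper : ∀ S {F} → T (S F) → F ≼ ⋃ S
    ⋃-upper S F∈S x x∈F = fromWitness (_ , F∈S , x∈F)

    ⋃-least : ∀ S {G} → (∀ F → T (S F) → F ≼ G) → ⋃ S ≼ G
    ⋃-least S h x x∈ = let F , F∈S , x∈F = toWitness x∈ in h F F∈S x x∈F

    -- Stronger than comparability by inclusion: nothing falls strictly between `G` and `next G`.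
    -- This lets the induction pass a successor.
    Comparable : Subset → Subset → Set ℓ
    Comparable F G = F ≼ G ⊎ next G ≼ F

    comparable-next : ∀ {F G} → Comparable F G → Comparable G F → Comparable (next F) G
    comparable-next _        (inj₂ F⁺≼G) = inj₁ F⁺≼G
    comparable-next {F} (inj₂ G⁺≼F) (inj₁ _)  = inj₂ λ x → extend-≼ F em x ∘ G⁺≼F x
    comparable-next {F} {G} (inj₁ F≼G) (inj₁ G≼F) =
      -- Here `F` and `G` are equal, by function extensionality, hence so are their successors.
      inj₂ (subst (λ H → next H ≼ next F) (≼-antisym F≼G G≼F) λ _ → id)

    comparable-⋃ : ∀ S {G} → (∀ F → T (S F) → Comparable F G) → Comparable (⋃ S) G
    comparable-⋃ S {G} h with em {Σ[ F ∈ Subset ] (T (S F) × next G ≼ F)}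
    ... | yes (F , F∈S , G⁺≼F) = inj₂ λ x → ⋃-upper S F∈S x ∘ G⁺≼F x
    ... | no none = inj₁ (⋃-least S λ F F∈S →
      [ id , (λ G⁺≼F → contradiction (F , F∈S , G⁺≼F) none) ]′ (h F F∈S))

    -- A double induction. The successor case needs both orders of the pair; `converse` supplies the
    -- other one by an inner induction on `G` with `F` fixed.
    comparable : ∀ {F G} → Tower F → Tower G → Comparable F G
    comparable (lim S t) u = comparable-⋃ S λ F F∈S → comparable (t F F∈S) u
    comparable {G = G} (step {F} t) u = comparable-next (comparable t u) (converse u)
      where
      converse : ∀ {G} → Tower G → Comparable G F
      converse (step u)  = comparable-next (converse u) (comparable t u)
      converse (lim S u) = comparable-⋃ S λ G G∈S → converse (u G G∈S)

    linear : ∀ {F G} → Tower F → Tower G → F ≼ G ⊎ G ≼ F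
    linear {G = G} t u with comparable t u
    ... | inj₁ F≼G  = inj₁ F≼G
    ... | inj₂ G⁺≼F = inj₂ λ x → G⁺≼F x ∘ extend-≼ G em x

    -- Each entry lies in some member of `S`, and by linearity the largest of these finitely many
    -- members contains them all. The empty list is kept apart because `S` may be empty.
    finite-in-⋃ : ∀ S → (∀ F → T (S F) → Tower F) → ∀ L → All (T ∘ ⋃ S) L →
                  L ≡ [] ⊎ (Σ[ F ∈ Subset ] (T (S F) × All (T ∘ F) L))
    finite-in-⋃ S t []      []       = inj₁ refl
    finite-in-⋃ S t (x ∷ L) (p ∷ ps) with F , F∈S , x∈F ← toWitness p | finite-in-⋃ S t L ps
    ... | inj₁ refl = inj₂ (F , F∈S , x∈F ∷ [])
    ... | inj₂ (G , G∈S , L⊆G) with linear (t F F∈S) (t G G∈S)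
    ...   | inj₁ F≼G = inj₂ (G , G∈S , F≼G x x∈F ∷ L⊆G)
    ...   | inj₂ G≼F = inj₂ (F , F∈S , x∈F ∷ All.map (G≼F _) L⊆G)

    tower-consistent : ∀ {F} → Tower F → Consistent F
    tower-consistent (step {F} t) = extend-consistent F em (tower-consistent t)
    tower-consistent (lim S t) L L∈ with finite-in-⋃ S t L L∈
    ... | inj₁ refl            = Con-[]
    ... | inj₂ (F , F∈S , L∈F) = tower-consistent (t F F∈S) L L∈F

    isTower : Subset → Bool
    isTower F = ⌊ em {Tower F} ⌋

    top-tower : Tower (⋃ isTower)
    top-tower = lim isTower λ _ → toWitness

  maximal : Subset
  maximal = ⋃ isTower

  maximal-consistent : Consistent maximal
  maximal-consistent = tower-consistent top-tower

  -- `next maximal` is again in the tower, hence included in the union `maximal` of the whole tower.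
  -- So `next` adds nothing, and no element is left to add.
  maximal-closed : ∀ x → (∀ L → All (T ∘ maximal) L → Con (x ∷ L)) → T (maximal x)
  maximal-closed x con = decidable-stable (T? _) λ x∉ →
    extend-maximal maximal em (⋃-upper isTower (fromWitness (step top-tower))) x (x∉ , con)

record Ultrafilter (I : Set ℓ) : Set (Level.suc ℓ) where
  field
    Large  : (I → Set ℓ) → Set ℓ
    mono   : ∀ {P Q} → (∀ i → P i → Q i) → Large P → Large Q
    _∩_    : ∀ {P Q} → Large P → Large Q → Large (λ i → P i × Q i)
    proper : ¬ Large (λ _ → Polymorphic.⊥)
    ultra  : ∀ P → Large P ⊎ Large (λ i → ¬ P i)

  universal : ∀ {P} → (∀ i → P i) → Large P
  universal {P} p with ultra P
  ... | inj₁ large = large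
  ... | inj₂ small = mono (λ i ¬p → ⊥-elim (¬p (p i))) small

  nonempty : ExcludedMiddle ℓ → ∀ {P} → Large P → Σ[ i ∈ I ] P i
  nonempty em large = decidable-stable em λ none →
    proper (mono (λ i p → ⊥-elim (none (i , p))) large)

-- The sets `B k` form a filter base. A maximal family whose finite intersections meet every `B k`
-- is taken, and `P` is large when its characteristic function `χ P` belongs to it.
ultrafilter :
  ExcludedMiddle ℓ → Extensionality ℓ ℓ → {I K : Set ℓ} (B : K → I → Set ℓ) → K →
  (∀ k → Σ[ i ∈ I ] B k i) →
  (∀ k l → Σ[ m ∈ K ] (∀ i → B m i → B k i × B l i)) →
  Σ[ U ∈ Ultrafilter I ] (∀ k → Ultrafilter.Large U (B k))
ultrafilter {ℓ} em ext {I} {K} B k₀ inhabited directed = record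
  { Large  = λ P → Level.Lift ℓ (T (maximal (χ P)))
  ; mono   = λ {P} {Q} P⊆Q (Level.lift p) →
      closed Q (χ P ∷ []) (p ∷ []) k₀ λ { i _ (q ∷ []) → P⊆Q i (toWitness q) }
  ; _∩_    = λ {P} {Q} (Level.lift p) (Level.lift q) →
      closed _ (χ P ∷ χ Q ∷ []) (p ∷ q ∷ []) k₀ λ { i _ (r ∷ s ∷ []) → toWitness r , toWitness s }
  ; proper = λ (Level.lift p) → ∅-empty (maximal-consistent _ (p ∷ []) k₀)
  ; ultra  = ultra
  } , λ k → closed (B k) [] [] k λ i b _ → b
  where
  χ : (I → Set ℓ) → I → Bool
  χ P i = ⌊ em {P i} ⌋

  Con : List (I → Bool) → Set ℓ
  Con L = ∀ k → Σ[ i ∈ I ] (B k i × All (λ X → T (X i)) L)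

  Con-anti : ∀ {L L′} → L ⊆ L′ → Con L′ → Con L
  Con-anti L⊆L′ con k = let i , b , i∈ = con k in i , b , All.anti-mono L⊆L′ i∈

  Con-[] : Con []
  Con-[] k = let i , b = inhabited k in i , b , []

  open TeichmüllerTukey em ext Con Con-anti Con-[]

  -- If a base set and finitely many members intersect inside `P`, then `P` can be added: by
  -- directedness some base set lies in both `B k` and `B k′`, and its points common to all the
  -- listed members lie in `P`.
  closed : ∀ P L → All (T ∘ maximal) L → ∀ k →
           (∀ i → B k i → All (λ X → T (X i)) L → P i) → Level.Lift ℓ (T (maximal (χ P)))
  closed P L L∈ k h = Level.lift (maximal-closed (χ P) λ L′ L′∈ k′ →
    let m , m≤ = directed k k′
        i , b , i∈ = maximal-consistent (L List.++ L′) (All.++⁺ L∈ L′∈) m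
        b₁ , b₂ = m≤ i b
    in i , b₂ , fromWitness (h i b₁ (All.++⁻ˡ L i∈)) ∷ All.++⁻ʳ L i∈)

  ∅-empty : ¬ (Σ[ i ∈ I ] (B k₀ i × All (λ X → T (X i)) (χ (λ _ → Polymorphic.⊥) ∷ [])))
  ∅-empty (i , _ , q ∷ []) = lower (toWitness q)

  ultra : ∀ P → Level.Lift ℓ (T (maximal (χ P))) ⊎ Level.Lift ℓ (T (maximal (χ λ i → ¬ P i)))
  -- Either some base set and finitely many members have no common point in `P`, and the complement
  -- is large, or `P` meets all such intersections and can be added.
  ultra P with em {Σ[ L ∈ List (I → Bool) ] Σ[ k ∈ K ]
                     (All (T ∘ maximal) L × (∀ i → B k i → All (λ X → T (X i)) L → ¬ P i))}
  ... | yes (L , k , L∈ , h) = inj₂ (closed _ L L∈ k h)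
  ... | no none = inj₁ (Level.lift (maximal-closed (χ P) λ L L∈ k →
    decidable-stable em λ empty →
      none (L , k , L∈ , λ i b i∈ p → empty (i , b , fromWitness p ∷ i∈))))

-- Ultrapowers

module Ultrapower
  (em : ExcludedMiddle ℓ) (M : Structure ℓ) {I : Set ℓ} (U : Ultrafilter I)
  where
  open Structure M hiding (refl; sym; trans)
  open Ultrafilter U

  ultrapower : Structure ℓ
  ultrapower = record
    { Carrier       = I → Carrier
    ; _≈_           = λ f g → Large λ i → f i ≈ g i
    ; 0#            = λ _ → 0#
    ; 1#            = λ _ → 1#
    ; _+_           = λ f g i → f i + g i
    ; _*_           = λ f g i → f i * g i
    ; _<_           = λ f g → Large λ i → f i < g i
    ; isEquivalence = record
      { refl  = universal λ _ → Structure.refl M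
      ; sym   = mono λ _ → Structure.sym M
      ; trans = λ p q → mono (λ _ (r , s) → Structure.trans M r s) (p ∩ q)
      }
    ; +-cong        = λ p q → mono (λ _ (r , s) → +-cong r s) (p ∩ q)
    ; *-cong        = λ p q → mono (λ _ (r , s) → *-cong r s) (p ∩ q)
    ; <-resp-≈      = (λ p q → mono (λ _ (r , s) → proj₁ <-resp-≈ r s) (p ∩ q))
                    , (λ p q → mono (λ _ (r , s) → proj₂ <-resp-≈ r s) (p ∩ q))
    }

  at : I → Vec (I → Carrier) n → Vec Carrier n
  at i = map (λ f → f i)

  ⟦⟧-at : ∀ (t : Term n) ρ i → ⟦ ultrapower ⟧ t ρ i ≡ ⟦ M ⟧ t (at i ρ)
  ⟦⟧-at (var j) ρ i = sym (lookup-map j (λ f → f i) ρ)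
  ⟦⟧-at 𝟘       ρ i = refl
  ⟦⟧-at 𝟙       ρ i = refl
  ⟦⟧-at (s ⊞ t) ρ i = cong₂ _+_ (⟦⟧-at s ρ i) (⟦⟧-at t ρ i)
  ⟦⟧-at (s ⊠ t) ρ i = cong₂ _*_ (⟦⟧-at s ρ i) (⟦⟧-at t ρ i)

  -- Łoś's theorem. Disjunction and implication rest on `ultra`; at quantifiers excluded middle
  -- yields a witness or counterexample index by index, and these form an element of the ultrapower.
  łoś : ∀ (φ : Formula n) ρ →
        (ultrapower ⊨ φ [ ρ ]) ⇔ Large (λ i → M ⊨ φ [ at i ρ ])
  łoś (s ≐ t) ρ = mk⇔
    (mono λ i → subst₂ _≈_ (⟦⟧-at s ρ i) (⟦⟧-at t ρ i))
    (mono λ i → subst₂ _≈_ (sym (⟦⟧-at s ρ i)) (sym (⟦⟧-at t ρ i)))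
  łoś (s ⋖ t) ρ = mk⇔
    (mono λ i → subst₂ _<_ (⟦⟧-at s ρ i) (⟦⟧-at t ρ i))
    (mono λ i → subst₂ _<_ (sym (⟦⟧-at s ρ i)) (sym (⟦⟧-at t ρ i)))
  łoś ⊥′       ρ = mk⇔ (λ { (Level.lift ()) }) (⊥-elim ∘ proper)
  łoś (φ ∧′ ψ) ρ =
    mk⇔ (λ (p , q) → p ∩ q) (λ r → mono (λ _ → proj₁) r , mono (λ _ → proj₂) r)
    ⇔-∘ (łoś φ ρ ×-⇔ łoś ψ ρ)
  łoś (φ ∨′ ψ) ρ =
    mk⇔ [ mono (λ _ → inj₁) , mono (λ _ → inj₂) ]′ split ⇔-∘ (łoś φ ρ ⊎-⇔ łoś ψ ρ)
    where
    split : Large (λ i → M ⊨ φ ∨′ ψ [ at i ρ ]) →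
            Large (λ i → M ⊨ φ [ at i ρ ]) ⊎ Large (λ i → M ⊨ ψ [ at i ρ ])
    split r with ultra (λ i → M ⊨ φ [ at i ρ ])
    ... | inj₁ p  = inj₁ p
    ... | inj₂ ¬p = inj₂ (mono
      (λ { _ (inj₁ p , ¬p) → contradiction p ¬p ; _ (inj₂ q , _) → q }) (r ∩ ¬p))
  łoś (φ ⇒′ ψ) ρ =
    mk⇔ distribute (λ r p → mono (λ _ (f , x) → f x) (r ∩ p)) ⇔-∘
    →-cong-⇔ (łoś φ ρ) (łoś ψ ρ)
    where
    distribute : (Large (λ i → M ⊨ φ [ at i ρ ]) → Large (λ i → M ⊨ ψ [ at i ρ ])) →
                 Large (λ i → M ⊨ φ ⇒′ ψ [ at i ρ ])
    distribute f with ultra (λ i → M ⊨ φ [ at i ρ ])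
    ... | inj₁ p  = mono (λ _ q _ → q) (f p)
    ... | inj₂ ¬p = mono (λ _ ¬p p → contradiction p ¬p) ¬p
  łoś (∀′ φ) ρ = mk⇔ choose (λ r f → from (łoś φ (f ∷ ρ)) (mono (λ i p → p (f i)) r))
    where
    -- The decision is an argument so that `sound` can match on it.
    counterexample : ∀ i → Dec (Σ[ x ∈ Carrier ] ¬ (M ⊨ φ [ x ∷ at i ρ ])) → Carrier
    counterexample i (yes (x , _)) = x
    -- Without a counterexample any value serves.
    counterexample i (no _)        = 0#

    sound : ∀ i d → (M ⊨ φ [ counterexample i d ∷ at i ρ ]) → M ⊨ ∀′ φ [ at i ρ ]
    sound i (yes (x , ¬p)) p   = contradiction p ¬p
    sound i (no none)      _ x = decidable-stable em λ ¬p → none (x , ¬p)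

    choose : (ultrapower ⊨ ∀′ φ [ ρ ]) → Large (λ i → M ⊨ ∀′ φ [ at i ρ ])
    choose h = mono (λ i → sound i em) (to (łoś φ (_ ∷ ρ)) (h λ i → counterexample i em))
  łoś (∃′ φ) ρ = mk⇔ (λ (f , p) → mono (λ i q → f i , q) (to (łoś φ (f ∷ ρ)) p)) choose
    where
    example : ∀ i → Dec (M ⊨ ∃′ φ [ at i ρ ]) → Carrier
    example i (yes (x , _)) = x
    example i (no _)        = 0#

    sound : ∀ i d → (M ⊨ ∃′ φ [ at i ρ ]) → M ⊨ φ [ example i d ∷ at i ρ ]
    sound i (yes (x , p)) _ = p
    sound i (no none)     p = contradiction p none

    choose : Large (λ i → M ⊨ ∃′ φ [ at i ρ ]) → ultrapower ⊨ ∃′ φ [ ρ ]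
    choose r = (λ i → example i em) , from (łoś φ (_ ∷ ρ)) (mono (λ i → sound i em) r)

  diagonal : M ↪ ultrapower
  diagonal = record
    { to        = const
    ; cong      = λ p → universal λ _ → p
    ; injective = λ p → proj₂ (nonempty em p)
    ; 0-homo    = universal λ _ → Structure.refl M
    ; 1-homo    = universal λ _ → Structure.refl M
    ; +-homo    = λ _ _ → universal λ _ → Structure.refl M
    ; *-homo    = λ _ _ → universal λ _ → Structure.refl M
    ; mono      = λ p → universal λ _ → p
    ; cancel    = λ p → proj₂ (nonempty em p)
    }

  at-diagonal : ∀ i (ρ : Vec Carrier n) → at i (map const ρ) ≡ ρ
  at-diagonal i ρ = trans (sym (map-∘ (λ f → f i) const ρ)) (map-id ρ)

  -- At constant sequences the predicate in Łoś's theorem does not depend on the index.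
  diagonal-elementary : IsElementary diagonal
  diagonal-elementary φ ρ = ⇔-sym (łoś φ (map const ρ)) ⇔-∘ mk⇔
    (λ p → universal λ i → subst (M ⊨ φ [_]) (sym (at-diagonal i ρ)) p)
    (λ r → let i , p = nonempty em r in subst (M ⊨ φ [_]) (at-diagonal i ρ) p)

  ultrapower-⊨PA⁻ : M ⊨PA⁻ → ultrapower ⊨PA⁻
  ultrapower-⊨PA⁻ M⊨PA⁻ σ σ∈PA⁻ = to (diagonal-elementary σ []) (M⊨PA⁻ σ σ∈PA⁻)

-- From collection to elementarity of the supremum.

coll⇒sup-elementary :
  ExcludedMiddle ℓ → {M N : Structure ℓ} → M ⊨PA⁻ → (∀ n → M ⊨Coll-Σ n) →
  (N⊨PA⁻ : N ⊨PA⁻) (i : M ↪ N) → IsElementary i → IsElementary (sup↪N N⊨PA⁻ i)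
coll⇒sup-elementary {ℓ} em {M} {N} M⊨PA⁻ coll N⊨PA⁻ i M≺N =
  tarski-vaught (sup↪N N⊨PA⁻ i) em witness
  where
  module M = Structure M
  module N = Structure N
  module i = _↪_ i

  module _ {p : ℕ} (φ : Formula (suc p)) where
    χ : Formula (suc p)
    χ = rename suc (∃′ φ) ⇒′ φ

    χ-total : ∀ xs → Σ[ y ∈ ∣ M ∣ ] (M ⊨ χ [ y ∷ xs ])
    χ-total xs with em {M ⊨ ∃′ φ [ xs ]}
    ... | yes (y , q) = y , λ _ → q
    -- The premise of `χ` fails, so the default `0#` satisfies it vacuously.
    ... | no ¬q       = M.0# , λ q → contradiction (to (⊨-weaken M (∃′ φ) M.0# xs) q) ¬q

    -- Collection takes its variables in the order x⃗, y.
    x⃗y : Fin (suc p) → Fin (p ℕ.+ (1 ℕ.+ 0))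
    x⃗y zero    = p ↑ʳ zero
    x⃗y (suc j) = j ↑ˡ 1

    x⃗y-renames : ∀ (y : ∣ M ∣) xs j → lookup (xs ++ y ∷ []) (x⃗y j) ≡ lookup (y ∷ xs) j
    x⃗y-renames y xs zero    = lookup-++ʳ xs (y ∷ []) zero
    x⃗y-renames y xs (suc j) = lookup-++ˡ xs (y ∷ []) j

    -- The free variables of χ⁺ are y, x⃗, u⃗, v, in this order.
    χ⁺ : Formula (suc (p ℕ.+ (p ℕ.+ 1)))
    χ⁺ = rename (Fin.lift 1 (_↑ˡ (p ℕ.+ 1))) χ

    ⊨-χ⁺ : ∀ (K : Structure ℓ) y (xs : Vec ∣ K ∣ p) τ →
           (K ⊨ χ⁺ [ y ∷ xs ++ τ ]) ⇔ (K ⊨ χ [ y ∷ xs ])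
    ⊨-χ⁺ K y xs τ = ⊨-rename K (Fin.lift 1 (_↑ˡ (p ℕ.+ 1)))
      (λ { zero → refl ; (suc j) → lookup-++ˡ xs τ j }) χ

    x<u : Fin p → Formula (p ℕ.+ (p ℕ.+ 1))
    x<u j = var (j ↑ˡ (p ℕ.+ 1)) ⋖ var (p ↑ʳ (j ↑ˡ 1))

    v : Term (p ℕ.+ (p ℕ.+ 1))
    v = var (p ↑ʳ (p ↑ʳ zero))

    -- The conclusion of collection for `χ` as a single formula in u⃗ and v, so that elementarity of
    -- `i` can carry it to `N`.
    bounded : Formula (p ℕ.+ 1)
    bounded = ∀* p (⋀ x<u ⇒′ ∃′ (var zero ⋖ renameᵗ suc v ∧′ χ⁺))

    module _ (K : Structure ℓ) (us : Vec ∣ K ∣ p) (w : ∣ K ∣) where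
      open Structure K using (_<_)

      ⊨-x<u : ∀ (xs : Vec ∣ K ∣ p) j →
              (K ⊨ x<u j [ xs ++ us ++ w ∷ [] ]) ≡ (lookup xs j < lookup us j)
      ⊨-x<u xs j = cong₂ _<_ (lookup-++ˡ xs _ j)
        (trans (lookup-++ʳ xs _ (j ↑ˡ 1)) (lookup-++ˡ us _ j))

      ⟦v⟧ : ∀ (xs : Vec ∣ K ∣ p) → lookup (xs ++ us ++ w ∷ []) (p ↑ʳ (p ↑ʳ zero)) ≡ w
      ⟦v⟧ xs = trans (lookup-++ʳ xs _ (p ↑ʳ zero)) (lookup-++ʳ us _ zero)

      ⊨-bounded : (K ⊨ bounded [ us ++ w ∷ [] ]) ⇔
        (∀ xs → (∀ j → lookup xs j < lookup us j) →
           Σ[ y ∈ ∣ K ∣ ] (y < w × (K ⊨ χ [ y ∷ xs ])))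
      ⊨-bounded = (∀-cong-⇔ λ xs → →-cong-⇔
          (∀-cong-⇔ (λ j → mk⇔ (subst id (⊨-x<u xs j)) (subst id (sym (⊨-x<u xs j))))
            ⇔-∘ ⊨-⋀ K x<u _)
          (∃-cong-⇔ λ y →
            mk⇔ (subst (y <_) (⟦v⟧ xs)) (subst (y <_) (sym (⟦v⟧ xs)))
            ×-⇔ ⊨-χ⁺ K y xs _))
        ⇔-∘ ⊨-∀* K p _ _

    -- All parameters of `φ` are among the bounded variables x⃗, so collection is applied with an
    -- empty tuple z⃗.
    M-bound : ∀ us → Σ[ w ∈ ∣ M ∣ ] (M ⊨ bounded [ us ++ w ∷ [] ])
    M-bound us = bound (PrenexForm.coll-prenex em M coll p 1 0 (rename x⃗y χ) [] us
      (λ xs _ → let y , q = χ-total xs in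
         y ∷ [] , from (⊨-rename M x⃗y (x⃗y-renames y xs) χ) q))
      where
      below : ∀ {w xs} → Σ[ ys ∈ Vec ∣ M ∣ 1 ]
                (Pointwise M._<_ ys (w ∷ []) × (M ⊨ rename x⃗y χ [ xs ++ ys ++ [] ])) →
              Σ[ y ∈ ∣ M ∣ ] (y M.< w × (M ⊨ χ [ y ∷ xs ]))
      below {xs = xs} (y ∷ [] , y<w ∷ [] , q) =
        y , y<w , to (⊨-rename M x⃗y (x⃗y-renames y xs) χ) q

      bound : Σ[ ws ∈ Vec ∣ M ∣ 1 ] (∀ xs → Pointwise M._<_ xs us → Σ[ ys ∈ Vec ∣ M ∣ 1 ]
                (Pointwise M._<_ ys ws × (M ⊨ rename x⃗y χ [ xs ++ ys ++ [] ]))) →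
              Σ[ w ∈ ∣ M ∣ ] (M ⊨ bounded [ us ++ w ∷ [] ])
      bound (w ∷ [] , h) = w , from (⊨-bounded M us w) λ xs xs<us →
        below (h xs (extensional⇒inductive (extensional xs<us)))

    -- The bound stays in `M`, while x⃗ now ranges over all tuples of `N` below u⃗.
    N-bound : ∀ us → Σ[ w ∈ ∣ M ∣ ]
      (∀ xs → (∀ j → lookup xs j N.< lookup (map i.to us) j) →
         Σ[ y ∈ ∣ N ∣ ] (y N.< i.to w × (N ⊨ χ [ y ∷ xs ])))
    N-bound us = let w , h = M-bound us in
      w , to (⊨-bounded N (map i.to us) (i.to w))
             (subst (N ⊨ bounded [_]) (map-++ i.to us (w ∷ [])) (to (M≺N bounded _) h))

    -- Parameters from the supremum lie below elements of `M`, so `N-bound` applies to them; its `y`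
    -- is below `w` from `M` and thus in the supremum.
    witness : ∀ ρ → (N ⊨ ∃′ φ [ map proj₁ ρ ]) →
              Σ[ x ∈ ∣ sup N⊨PA⁻ i ∣ ] (N ⊨ φ [ proj₁ x ∷ map proj₁ ρ ])
    witness ρ ∃φ =
      let w , h       = N-bound (map bound+1 ρ)
          y , y<w , q = h (map proj₁ ρ) ρ<bound+1
      in (y , w , inj₁ y<w) , q (from (⊨-weaken N (∃′ φ) y _) ∃φ)
      where
      -- Membership in the supremum gives a weak bound, collection asks for a strict one.
      bound+1 : ∣ sup N⊨PA⁻ i ∣ → ∣ M ∣
      bound+1 (_ , b , _) = b M.+ M.1#

      ρ<bound+1 : ∀ j → lookup (map proj₁ ρ) j N.< lookup (map i.to (map bound+1 ρ)) j
      ρ<bound+1 j = subst₂ N._<_ (sym (lookup-map j proj₁ ρ))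
        (sym (trans (lookup-map j i.to (map bound+1 ρ)) (cong i.to (lookup-map j bound+1 ρ))))
        (≤-<-trans N⊨PA⁻ (proj₂ (proj₂ (lookup ρ j))) (i.mono (x<x+1 M⊨PA⁻ _)))

-- From elementarity of the supremum to collection.

sup-elementary⇒coll :
  ExcludedMiddle ℓ → Extensionality ℓ ℓ → {M : Structure ℓ} → M ⊨PA⁻ →
  (∀ (N : Structure ℓ) (N⊨PA⁻ : N ⊨PA⁻) (i : M ↪ N) → IsElementary i →
     IsElementary (sup↪N N⊨PA⁻ i)) →
  ∀ p q r φ → (M ⊨Coll) p q r φ
sup-elementary⇒coll em ext {M} M⊨PA⁻ sup≺N p q r φ zs us h =
  decidable-stable em λ uncollected →
    Failure.absurd (unbounded uncollected) (proj₁ finalSegments) (proj₂ finalSegments)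
  where
  open Structure M using (_<_; _≤_; _+_; 0#; 1#)

  -- One bound for all components of y⃗ lets elements of `M` index the failure of collection;
  -- constant tuples are a special case of all bounding tuples.
  Below : ∣ M ∣ → Vec ∣ M ∣ p → Set _
  Below v xs = Σ[ ys ∈ Vec ∣ M ∣ q ] (Pointwise _<_ ys (replicate q v) × (M ⊨ φ [ xs ++ ys ++ zs ]))

  Unbounded : ∣ M ∣ → Set _
  Unbounded v = Σ[ xs ∈ Vec ∣ M ∣ p ] (Pointwise _<_ xs us × ¬ Below v xs)

  unbounded :
    ¬ (Σ[ vs ∈ Vec ∣ M ∣ q ] (∀ xs → Pointwise _<_ xs us →
         Σ[ ys ∈ Vec ∣ M ∣ q ] (Pointwise _<_ ys vs × (M ⊨ φ [ xs ++ ys ++ zs ])))) →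
    ∀ v → Unbounded v
  unbounded uncollected v = decidable-stable em λ none →
    uncollected (replicate q v , λ xs xs<us → decidable-stable em λ ¬below →
      none (xs , xs<us , ¬below))

  finalSegments : Σ[ U ∈ Ultrafilter ∣ M ∣ ] (∀ b → Ultrafilter.Large U (b <_))
  finalSegments = ultrafilter em ext _<_ 0#
    (λ b → b + 1# , x<x+1 M⊨PA⁻ b)
    -- The sum is an upper bound of both, so its final segment lies in both final segments.
    (λ b b′ → b + b′ , λ v b+b′<v →
      ≤-<-trans M⊨PA⁻ (x≤x+y M⊨PA⁻ b b′) b+b′<v ,
      ≤-<-trans M⊨PA⁻ (y≤x+y M⊨PA⁻ b b′) b+b′<v)

  module Failure
    (c : ∀ v → Unbounded v)
    (U : Ultrafilter ∣ M ∣) (final : ∀ b → Ultrafilter.Large U (b <_))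
    where
    open Ultrafilter U
    open Ultrapower em M U

    N⊨PA⁻ : ultrapower ⊨PA⁻
    N⊨PA⁻ = ultrapower-⊨PA⁻ M⊨PA⁻

    supM : Structure _
    supM = sup N⊨PA⁻ diagonal

    supM≺N : IsElementary (sup↪N N⊨PA⁻ diagonal)
    supM≺N = sup≺N ultrapower N⊨PA⁻ diagonal diagonal-elementary

    -- The class of the sequence of failures c(v). Its components stay below the fixed u⃗ and so
    -- belong to the supremum.
    cs : Vec ∣ supM ∣ p
    cs = tabulate λ j → (λ v → lookup (proj₁ (c v)) j) , lookup us j ,
      inj₁ (universal λ v → Pointwise.lookup (proj₁ (proj₂ (c v))) j)

    ρ : Vec ∣ supM ∣ (p ℕ.+ r)
    ρ = cs ++ map (_↪_.to (M↪sup N⊨PA⁻ diagonal)) zs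

    at-ρ : ∀ v → at v (map proj₁ ρ) ≡ proj₁ (c v) ++ zs
    at-ρ v = trans (sym (map-∘ (λ f → f v) proj₁ ρ))
      (trans (map-++ (λ x → proj₁ x v) cs _) (cong₂ _++_
        (trans (sym (tabulate-∘ (λ x → proj₁ x v) _)) (tabulate∘lookup (proj₁ (c v))))
        (trans (sym (map-∘ _ _ zs)) (map-id zs))))

    -- `∃*` binds the leading variables, so y⃗ is moved in front of x⃗.
    swap : Fin (p ℕ.+ (q ℕ.+ r)) → Fin (q ℕ.+ (p ℕ.+ r))
    swap =
      [ (λ j → q ↑ʳ (j ↑ˡ r))
      , [ _↑ˡ (p ℕ.+ r) , (λ j → q ↑ʳ (p ↑ʳ j)) ]′ ∘ splitAt q
      ]′ ∘ splitAt p

    swap-renames : ∀ (xs : Vec ∣ M ∣ p) (ys : Vec ∣ M ∣ q) j →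
                   lookup (ys ++ xs ++ zs) (swap j) ≡ lookup (xs ++ ys ++ zs) j
    swap-renames xs ys j rewrite lookup-splitAt p xs (ys ++ zs) j with splitAt p j
    ... | inj₁ j = trans (lookup-++ʳ ys _ (j ↑ˡ r)) (lookup-++ˡ xs zs j)
    ... | inj₂ j rewrite lookup-splitAt q ys zs j with splitAt q j
    ...   | inj₁ j = lookup-++ˡ ys _ j
    ...   | inj₂ j = trans (lookup-++ʳ ys _ (p ↑ʳ j)) (lookup-++ʳ xs zs j)

    ψ : Formula (q ℕ.+ (p ℕ.+ r))
    ψ = rename swap φ

    -- At each index `v` the premise of collection applies to c(v), which is below u⃗; Łoś's theorem
    -- does the rest.
    N⊨∃ψ : ultrapower ⊨ ∃* q ψ [ map proj₁ ρ ]
    N⊨∃ψ = from (łoś (∃* q ψ) _) (universal λ v →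
      let xs , xs<us , _ = c v
          ys , s = h xs xs<us
      in subst (M ⊨ ∃* q ψ [_]) (sym (at-ρ v))
           (from (⊨-∃* M q ψ (xs ++ zs)) (ys , from (⊨-rename M swap (swap-renames xs ys) φ) s)))

    -- Each entry is bounded by some `b` of `M`, and `b < v` for almost all `v`.
    eventually-below : ∀ {k} (ys : Vec ∣ supM ∣ k) →
      Large λ v → Pointwise _<_ (at v (map proj₁ ys)) (replicate k v)
    eventually-below []                 = universal λ _ → []
    eventually-below ((y , b , y≤b) ∷ ys) =
      mono (λ v ((y≤b , b<v) , rest) → ≤-<-trans M⊨PA⁻ y≤b b<v ∷ rest)
        ((large-≤ y≤b ∩ final b) ∩ eventually-below ys)
      where
      large-≤ : Structure._≤_ ultrapower y (const b) → Large (λ v → y v ≤ b)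
      large-≤ = [ mono (λ _ → inj₁) , mono (λ _ → inj₂) ]′

    -- Elementarity brings the existential statement down from the ultrapower, so that y⃗ may be
    -- taken in the supremum.
    sup-witness : Σ[ ys ∈ Vec ∣ supM ∣ q ] (supM ⊨ ψ [ ys ++ ρ ])
    sup-witness = to (⊨-∃* supM q ψ ρ) (from (supM≺N (∃* q ψ) ρ) N⊨∃ψ)

    at-++ρ : ∀ v (ys : Vec ∣ supM ∣ q) →
             at v (map proj₁ (ys ++ ρ)) ≡ at v (map proj₁ ys) ++ proj₁ (c v) ++ zs
    at-++ρ v ys = trans (cong (at v) (map-++ proj₁ ys ρ))
      (trans (map-++ _ (map proj₁ ys) (map proj₁ ρ)) (cong (at v (map proj₁ ys) ++_) (at-ρ v)))

    eventually-witness : ∀ ys → (supM ⊨ ψ [ ys ++ ρ ]) →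
      Large λ v → M ⊨ ψ [ at v (map proj₁ ys) ++ proj₁ (c v) ++ zs ]
    eventually-witness ys s =
      mono (λ v → subst (M ⊨ ψ [_]) (at-++ρ v ys)) (to (łoś ψ _) (to (supM≺N ψ (ys ++ ρ)) s))

    absurd : ⊥
    absurd = no-witness sup-witness
      where
      no-witness : ¬ (Σ[ ys ∈ Vec ∣ supM ∣ q ] (supM ⊨ ψ [ ys ++ ρ ]))
      -- For almost all `v` the values of y⃗ at `v` are below `v` and satisfy `φ` with c(v), against
      -- the choice of c(v).
      no-witness (ys , s) = proper (mono
        (λ v (below , t) → contradiction
          (_ , below , to (⊨-rename M swap (swap-renames (proj₁ (c v)) _) φ) t)
          (proj₂ (proj₂ (c v))))
        (eventually-below ys ∩ eventually-witness ys s))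

-- Equivalence of collection with the two elementarity conditions.

corollary4p7 :
  ∀ {ℓ} → ExcludedMiddle ℓ → Extensionality ℓ ℓ →
  (M : Structure ℓ) → M ⊨PA⁻ →
  let
    cond1 = ∀ n → M ⊨Coll-Σ n
    cond2 = ∀ (N : Structure ℓ) (N⊨PA⁻ : N ⊨PA⁻) (i : M ↪ N) → IsElementary i →
            IsElementary (M↪sup N⊨PA⁻ i) × IsElementary (sup↪N N⊨PA⁻ i)
    cond3 = ∀ (N : Structure ℓ) (N⊨PA⁻ : N ⊨PA⁻) (i : M ↪ N) → IsElementary i →
            IsElementary (sup↪N N⊨PA⁻ i)
  in (cond1 ⇔ cond2) × (cond2 ⇔ cond3)
corollary4p7 em ext M M⊨PA⁻ =
  mk⇔ (λ coll → 3⇒2 λ N → coll⇒sup-elementary em M⊨PA⁻ coll)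
      (λ cond2 n p q r φ _ → sup-elementary⇒coll em ext M⊨PA⁻ (2⇒3 cond2) p q r φ) ,
  mk⇔ 2⇒3 3⇒2
  where
  2⇒3 : (∀ N (N⊨PA⁻ : N ⊨PA⁻) (i : M ↪ N) → IsElementary i →
           IsElementary (M↪sup N⊨PA⁻ i) × IsElementary (sup↪N N⊨PA⁻ i)) →
        ∀ N (N⊨PA⁻ : N ⊨PA⁻) (i : M ↪ N) → IsElementary i → IsElementary (sup↪N N⊨PA⁻ i)
  2⇒3 f N N⊨PA⁻ i M≺N = proj₂ (f N N⊨PA⁻ i M≺N)

  3⇒2 : (∀ N (N⊨PA⁻ : N ⊨PA⁻) (i : M ↪ N) → IsElementary i →
           IsElementary (sup↪N N⊨PA⁻ i)) →
        ∀ N (N⊨PA⁻ : N ⊨PA⁻) (i : M ↪ N) → IsElementary i →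
        IsElementary (M↪sup N⊨PA⁻ i) × IsElementary (sup↪N N⊨PA⁻ i)
  3⇒2 f N N⊨PA⁻ i M≺N =
    let sup≺N = f N N⊨PA⁻ i M≺N in
    sup↪N-elementary⇒M↪sup-elementary N⊨PA⁻ i M≺N sup≺N , sup≺N
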